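{- Let $n$ be an even positive integer and let $\mathrm{F}_1(n)$ be the family of all $1$-factors (perfect matchings) of the complete graph $K_n$. Then $\mathrm{poly}_{\mathrm{F}_1}(K_n)=\lfloor \log_2 n\rfloor$.
   Context: For a graph $G$ and a family $\mathcal{H}$ of subgraphs of $G$, an edge-coloring of $G$ is $\mathcal{H}$-polychromatic if every graph in $\mathcal{H}$ contains, on its edges, every color that is used on the edges of $G$. The $\mathcal{H}$-polychromatic number $\mathrm{poly}_{\mathcal{H}}(G)$ is the largest number of colors used in an $\mathcal{H}$-polychromatic edge-coloring of $G$. -}

module Defs where

open import Data.Nat using (ℕ; _≤_)
open import Data.Fin using (Fin; _<_)
open import Data.Bool using (Bool; true)
open import Data.Product using (Σ; ∃; _×_; _,_; proj₁; proj₂)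
open import Data.Sum using (_⊎_)
open import Relation.Binary.PropositionalEquality using (_≡_)

-- Edges of the complete graph K_n on vertex set Fin n:
-- unordered pairs {i, j}, represented canonically as (i , j) with i < j.
Edge : ℕ → Set
Edge n = Σ (Fin n × Fin n) (λ p → proj₁ p < proj₂ p)

Incident : ∀ {n} → Fin n → Edge n → Set
Incident v ((i , j) , _) = (v ≡ i) ⊎ (v ≡ j)

EdgeSet : ℕ → Set
EdgeSet n = Edge n → Bool

IsPerfectMatching : ∀ {n} → EdgeSet n → Set
IsPerfectMatching {n} M =
  (v : Fin n) → Σ (Edge n) λ e →
    (M e ≡ true) × Incident v e ×
    ((e' : Edge n) → M e' ≡ true → Incident v e' → e' ≡ e)

record Coloring (n k : ℕ) : Set where
  field
    colour  : Edge n → Fin k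
    allUsed : (a : Fin k) → ∃ λ e → colour e ≡ a

IsF1Polychromatic : ∀ {n k} → Coloring n k → Set
IsF1Polychromatic {n} {k} c =
  (M : EdgeSet n) → IsPerfectMatching M →
  (a : Fin k) → ∃ λ e → (M e ≡ true) × (Coloring.colour c e ≡ a)

PolyF1Is : ℕ → ℕ → Set
PolyF1Is n p =
  (Σ (Coloring n p) IsF1Polychromatic) ×
  ((k : ℕ) → Σ (Coloring n k) IsF1Polychromatic → k ≤ p)

{-# OPTIONS --safe #-}
-- Upper bound. Order the vertices one at a time, keeping the colouring polychromatic: among the
-- vertices not yet ordered, let v be one with the largest number of a-coloured edges (over all
-- colours a) to unordered vertices, recolour all its edges to unordered vertices with a, and
-- put v next in the order. If that destroyed a colour b, some perfect matching would have a
-- single b-coloured edge vy, and exchanging edges would show that y has more b-coloured edges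
-- than v has a-coloured ones. In the end every edge has the colour of its smaller end. A colour
-- that is never in the majority in a prefix of the order is missed by some perfect matching, so
-- every colour is at some point in the majority; this forces the number of vertices to double
-- with each colour, whence 2 ^ k ≤ n + 1, and 2 ^ k ≤ n by parity.
--
-- Lower bound. Colour the edge ij, i < j, with ⌊log₂ (i + 1)⌋, capped at k - 1.

module Submission where

open import Defs
open import Data.Nat
  using (ℕ; _<_; zero; suc; _+_; _*_; _∸_; _^_; _≤_; _⊓_; pred; ⌊_/2⌋; ⌈_/2⌉; z≤n; s≤s; _≤?_; _<?_)
open import Data.Nat.Properties hiding (_≟_; _≤?_; _<?_) renaming (<-cmp to ℕ-<-cmp)
open import Data.Nat.Divisibility using (_∣_; ∣m+n∣m⇒∣n; ∣1⇒≡1; ∣⇒≤; m∣m*n)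
open import Data.Nat.Logarithm using (⌊log₂_⌋; ⌊log₂⌋-mono-≤; ⌊log₂[2^n]⌋≡n)
open import Data.Nat.Logarithm.Core using (⌊log2⌋)
import Data.List.Extrema.Nat as Extrema
open import Data.Bool using (if_then_else_; true; false)
open import Data.Fin as Fin using (Fin; zero; suc; toℕ; fromℕ<; fromℕ; opposite)
open import Data.Fin.Properties as Fin
  using (_≟_; toℕ<n; toℕ-injective; toℕ-fromℕ<; toℕ-fromℕ; toℕ≤pred[n]; any?; pigeonhole;
         injective⇒≤; opposite-prop; opposite-involutive; <-cmp)
open import Data.Fin.Permutation using (Permutation′; permutation; transpose; _⟨$⟩ˡ_; _⟨$⟩ʳ_; inverseˡ; inverseʳ)
import Data.Fin.Permutation.Components as PC
open import Data.List using (List; []; _∷_; length; allFin; filter; cartesianProduct)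
open import Data.List.Membership.Propositional using (_∈_)
open import Data.List.Membership.Propositional.Properties
  using (∈-allFin; ∈-filter⁺; ∈-filter⁻; ∈-cartesianProduct⁺; ∈-cartesianProduct⁻)
open import Data.List.Membership.Setoid.Properties using (index-injective)
open import Data.List.Relation.Unary.Any using (here; there)
open import Data.List.Relation.Unary.All as All using (All)
open import Data.Product using (Σ; ∃; _×_; _,_; proj₁; proj₂)
open import Data.Sum using (_⊎_; inj₁; inj₂)
open import Function using (_∘_)
open import Induction.WellFounded using (Acc; acc)
open import Level using (Level)
open import Relation.Binary using (tri<; tri≈; tri>)
open import Relation.Binary.PropositionalEquality
open import Relation.Nullary using (¬_; Dec; yes; no; does; contradiction)
open import Relation.Nullary.Decidable using (_×-dec_; _⊎-dec_; ¬?; dec-true; dec-false)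
open import Relation.Unary using (Pred; Decidable)
open import Algebra.Properties.CommutativeMonoid.Sum +-0-commutativeMonoid
  using (sum; sum-permute; ∑-distrib-+)

private variable
  ℓ ℓ₁ ℓ₂ : Level
  k n : ℕ

-- Sums and counts over finite index sets

sum-mono-≤ : {f g : Fin n → ℕ} → (∀ i → f i ≤ g i) → sum f ≤ sum g
sum-mono-≤ {zero}  f≤g = z≤n
sum-mono-≤ {suc n} f≤g = +-mono-≤ (f≤g zero) (sum-mono-≤ (f≤g ∘ suc))

sum-mono-< : {f g : Fin n → ℕ} → (∀ i → f i ≤ g i) → ∀ j → f j < g j → sum f < sum g
sum-mono-< f≤g zero    fj<gj = +-mono-<-≤ fj<gj (sum-mono-≤ (f≤g ∘ suc))
sum-mono-< f≤g (suc j) fj<gj = +-mono-≤-< (f≤g zero) (sum-mono-< (f≤g ∘ suc) j fj<gj)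

indicator : {P : Set ℓ} → Dec P → ℕ
indicator P? = if does P? then 1 else 0

count : {P : Pred (Fin n) ℓ} → Decidable P → ℕ
count P? = sum λ i → indicator (P? i)

indicator-mono : {P : Set ℓ} {Q : Set ℓ₁} (P? : Dec P) (Q? : Dec Q) →
                 (P → Q) → indicator P? ≤ indicator Q?
indicator-mono (no _)  Q?       P⇒Q = z≤n
indicator-mono (yes p) (yes q)  P⇒Q = s≤s z≤n
indicator-mono (yes p) (no ¬q)  P⇒Q = contradiction (P⇒Q p) ¬q

indicator-strict : {P : Set ℓ} {Q : Set ℓ₁} (P? : Dec P) (Q? : Dec Q) →
                   ¬ P → Q → indicator P? < indicator Q?
indicator-strict (yes p) _       ¬p q = contradiction p ¬p
indicator-strict (no _)  (yes _) ¬p q = s≤s z≤n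
indicator-strict (no _)  (no ¬q) ¬p q = contradiction q ¬q

indicator-⊎ : {P : Set ℓ} {Q : Set ℓ₁} {R : Set ℓ₂} (P? : Dec P) (Q? : Dec Q) (R? : Dec R) →
              (P → ¬ Q) → (P → R) → (Q → R) → indicator P? + indicator Q? ≤ indicator R?
indicator-⊎ (yes p) (yes q) R? disj P⇒R Q⇒R = contradiction q (disj p)
indicator-⊎ (yes p) (no _)  R? disj P⇒R Q⇒R = indicator-mono (yes p) R? P⇒R
indicator-⊎ (no _)  Q?      R? disj P⇒R Q⇒R = indicator-mono Q? R? Q⇒R

indicator≤1 : {P : Set ℓ} (P? : Dec P) → indicator P? ≤ 1
indicator≤1 (yes _) = ≤-refl
indicator≤1 (no _)  = z≤n

module _ {P : Pred (Fin n) ℓ} {Q : Pred (Fin n) ℓ₁} (P? : Decidable P) (Q? : Decidable Q) where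

  count-mono : (∀ i → P i → Q i) → count P? ≤ count Q?
  count-mono P⊆Q = sum-mono-≤ λ i → indicator-mono (P? i) (Q? i) (P⊆Q i)

  count-strict : (∀ i → P i → Q i) → ∀ j → ¬ P j → Q j → count P? < count Q?
  count-strict P⊆Q j ¬pj qj =
    sum-mono-< (λ i → indicator-mono (P? i) (Q? i) (P⊆Q i)) j (indicator-strict (P? j) (Q? j) ¬pj qj)

  count-⊎ : {R : Pred (Fin n) ℓ₂} (R? : Decidable R) →
            (∀ i → P i → ¬ Q i) → (∀ i → P i → R i) → (∀ i → Q i → R i) →
            count P? + count Q? ≤ count R?
  count-⊎ R? disj P⊆R Q⊆R = begin
    count P? + count Q?
      ≡⟨ ∑-distrib-+ (indicator ∘ P?) (indicator ∘ Q?) ⟨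
    sum (λ i → indicator (P? i) + indicator (Q? i))
      ≤⟨ sum-mono-≤ (λ i → indicator-⊎ (P? i) (Q? i) (R? i) (disj i) (P⊆R i) (Q⊆R i)) ⟩
    count R? ∎
    where open ≤-Reasoning

sum≤n : (f : Fin n → ℕ) → (∀ i → f i ≤ 1) → sum f ≤ n
sum≤n {zero}  f f≤1 = z≤n
sum≤n {suc n} f f≤1 = +-mono-≤ (f≤1 zero) (sum≤n (f ∘ suc) (f≤1 ∘ suc))

count≤n : {P : Pred (Fin n) ℓ} (P? : Decidable P) → count P? ≤ n
count≤n P? = sum≤n _ λ i → indicator≤1 (P? i)

-- Perfect matchings as fixed-point-free involutions, and edge exchanges

record Matching (n : ℕ) : Set where
  field
    mate       : Fin n → Fin n
    involutive : ∀ v → mate (mate v) ≡ v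
    mate≢      : ∀ v → mate v ≢ v

  mate-injective : ∀ {v w} → mate v ≡ mate w → v ≡ w
  mate-injective {v} {w} eq = trans (sym (involutive v)) (trans (cong mate eq) (involutive w))

  count-mate : {P : Pred (Fin n) ℓ} (P? : Decidable P) → count (P? ∘ mate) ≡ count P?
  count-mate P? = sym (sum-permute (indicator ∘ P?) (permutation mate mate involutive involutive))

open Matching

-- A vertex `v` fixed by the reversal would give `n ≡ 2 * toℕ v + 1`, against evenness.
reversal : 2 ∣ n → Matching n
reversal {n} 2∣n .mate       = opposite
reversal {n} 2∣n .involutive = opposite-involutive
reversal {n} 2∣n .mate≢ v eq =
  contradiction (∣1⇒≡1 (∣m+n∣m⇒∣n (subst (2 ∣_) n≡ 2∣n) (m∣m*n (toℕ v)))) λ ()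
  where
  open ≡-Reasoning
  n≡ : n ≡ 2 * toℕ v + 1
  n≡ = begin
    n                           ≡⟨ m∸n+n≡m (toℕ<n v) ⟨
    n ∸ suc (toℕ v) + suc (toℕ v) ≡⟨ cong (_+ suc (toℕ v)) (trans (sym (opposite-prop v)) (cong toℕ eq)) ⟩
    toℕ v + suc (toℕ v)         ≡⟨ cong (toℕ v +_) (+-comm 1 (toℕ v)) ⟩
    toℕ v + (toℕ v + 1)         ≡⟨ +-assoc (toℕ v) (toℕ v) 1 ⟨
    toℕ v + toℕ v + 1           ≡⟨ cong (λ z → toℕ v + z + 1) (+-identityʳ (toℕ v)) ⟨
    2 * toℕ v + 1               ∎

conjugate : Permutation′ n → Matching n → Matching n
conjugate π σ .mate w = π ⟨$⟩ˡ mate σ (π ⟨$⟩ʳ w)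
conjugate π σ .involutive w = begin
  π ⟨$⟩ˡ mate σ (π ⟨$⟩ʳ (π ⟨$⟩ˡ mate σ (π ⟨$⟩ʳ w))) ≡⟨ cong (λ z → π ⟨$⟩ˡ mate σ z) (inverseʳ π) ⟩
  π ⟨$⟩ˡ mate σ (mate σ (π ⟨$⟩ʳ w))                 ≡⟨ cong (π ⟨$⟩ˡ_) (involutive σ _) ⟩
  π ⟨$⟩ˡ (π ⟨$⟩ʳ w)                                 ≡⟨ inverseˡ π ⟩
  w                                                 ∎
  where open ≡-Reasoning
conjugate π σ .mate≢ w eq =
  mate≢ σ (π ⟨$⟩ʳ w) (trans (sym (inverseʳ π)) (cong (π ⟨$⟩ʳ_) eq))

transposeˡ : (i j : Fin n) → PC.transpose i j i ≡ j
transposeˡ i j rewrite dec-true (i ≟ i) refl = refl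

transposeʳ : (i j : Fin n) → PC.transpose i j j ≡ i
transposeʳ i j with j ≟ i
... | yes j≡i = j≡i
... | no  _ rewrite dec-true (j ≟ j) refl = refl

transpose-fixes : (i j : Fin n) {w : Fin n} → w ≢ i → w ≢ j → PC.transpose i j w ≡ w
transpose-fixes i j {w} w≢i w≢j rewrite dec-false (w ≟ i) w≢i | dec-false (w ≟ j) w≢j = refl

record Twist (σ : Matching n) (y u : Fin n) : Set where
  field
    twisted  : Matching n
    twist-y  : mate twisted y ≡ mate σ u
    twist-σy : mate twisted (mate σ y) ≡ u
    twist-off : ∀ w → w ≢ y → w ≢ u → w ≢ mate σ y → w ≢ mate σ u → mate twisted w ≡ mate σ w

  twist-u : mate twisted u ≡ mate σ y
  twist-u = trans (cong (mate twisted) (sym twist-σy)) (involutive twisted _)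

  twist-σu : mate twisted (mate σ u) ≡ y
  twist-σu = trans (cong (mate twisted) (sym twist-y)) (involutive twisted _)

open Twist

-- Conjugation by the transposition of `y` and `u` makes these two vertices trade mates. The
-- hypotheses say that `y` and `u` lie on two different edges, so four distinct vertices are
-- involved.
twist : (σ : Matching n) (y u : Fin n) → y ≢ u → mate σ u ≢ y → Twist σ y u
twist σ y u y≢u σu≢y = record
  { twisted  = conjugate (transpose y u) σ
  ; twist-y  = trans (cong (PC.transpose u y ∘ mate σ) (transposeˡ y u))
                     (transpose-fixes u y (mate≢ σ u) σu≢y)
  ; twist-σy = trans (cong (PC.transpose u y ∘ mate σ)
                           (transpose-fixes y u (mate≢ σ y) λ σy≡u → σu≢y (flip σy≡u)))
                     (trans (cong (PC.transpose u y) (involutive σ y)) (transposeʳ u y))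
  ; twist-off = λ w w≢y w≢u w≢σy w≢σu →
      trans (cong (PC.transpose u y ∘ mate σ) (transpose-fixes y u w≢y w≢u))
            (transpose-fixes u y (w≢σu ∘ sym ∘ flip) (w≢σy ∘ sym ∘ flip))
  }
  where
  flip : ∀ {v w} → mate σ v ≡ w → mate σ w ≡ v
  flip refl = involutive σ _

-- Colourings of pairs and partial orderings

PairColouring : ℕ → ℕ → Set
PairColouring n k = Fin n → Fin n → Fin k

Symmetric : PairColouring n k → Set
Symmetric c = ∀ i j → c i j ≡ c j i

Polychromatic : PairColouring n k → Set
Polychromatic {n} c = (σ : Matching n) → ∀ a → ∃ λ w → c w (mate σ w) ≡ a

-- The order is the numbering itself: the vertices already placed are those below `s`, and placing
-- another one means renumbering.
OrderedUpTo : ℕ → PairColouring n k → Set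
OrderedUpTo s c = ∀ i j j′ → toℕ i < s → i Fin.< j → i Fin.< j′ → c i j ≡ c i j′

-- A matching `σ` for the relabelled colouring is carried to its conjugate by `π`, whose edges have
-- the same colours under `c`.
relabel-polychromatic : (π : Permutation′ n) {c : PairColouring n k} → Polychromatic c →
                        Polychromatic (λ i j → c (π ⟨$⟩ʳ i) (π ⟨$⟩ʳ j))
relabel-polychromatic π {c} poly σ a =
  let w , cw = poly τ a in
  π ⟨$⟩ˡ w , trans (cong (λ z → c z (mate τ w)) (inverseʳ π)) cw
  where
  τ : Matching _
  τ .mate w       = π ⟨$⟩ʳ mate σ (π ⟨$⟩ˡ w)
  τ .involutive w = trans (cong (λ z → π ⟨$⟩ʳ mate σ z) (inverseˡ π))
                          (trans (cong (π ⟨$⟩ʳ_) (involutive σ _)) (inverseʳ π))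
  τ .mate≢ w eq   = mate≢ σ (π ⟨$⟩ˡ w) (trans (sym (inverseˡ π)) (cong (π ⟨$⟩ˡ_) eq))

-- Monochromatic degrees towards the unordered vertices

module MonochromaticDegree (c : PairColouring n (suc k)) (s : ℕ) where

  -- The condition `u ≢ y` leaves out the diagonal, whose value is not the colour of an edge.
  Neighbour : Fin n → Fin (suc k) → Fin n → Set
  Neighbour y b u = s ≤ toℕ u × u ≢ y × c y u ≡ b

  neighbour? : ∀ y b → Decidable (Neighbour y b)
  neighbour? y b u = (s ≤? toℕ u) ×-dec (¬? (u ≟ y) ×-dec (c y u ≟ b))

  degree : Fin n → Fin (suc k) → ℕ
  degree y b = count (neighbour? y b)

  exists-max : s < n → ∃ λ v → ∃ λ a →
               s ≤ toℕ v × (∀ y b → s ≤ toℕ y → degree y b ≤ degree v a)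
  exists-max s<n = proj₁ best , proj₂ best , late , λ y b s≤y →
    All.lookup (Extrema.f[xs]≤f[argmax] {f = degree′} start candidates)
               (∈-cartesianProduct⁺ (∈-filter⁺ late? (∈-allFin y) s≤y) (∈-allFin b))
    where
    late? : Decidable λ (y : Fin n) → s ≤ toℕ y
    late? y = s ≤? toℕ y

    degree′ : Fin n × Fin (suc k) → ℕ
    degree′ (y , b) = degree y b

    start : Fin n × Fin (suc k)
    -- Default value of `argmax`: the vertex at position `s` is itself unordered, so the maximiser
    -- is unordered in every case.
    start = fromℕ< s<n , zero

    candidates : List (Fin n × Fin (suc k))
    candidates = cartesianProduct (filter late? (allFin n)) (allFin (suc k))

    best : Fin n × Fin (suc k)
    best = Extrema.argmax degree′ start candidates

    late : s ≤ toℕ (proj₁ best)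
    late = Extrema.argmax-all degree′ {P = λ x → s ≤ toℕ (proj₁ x)} {xs = candidates}
      (≤-reflexive (sym (toℕ-fromℕ< s<n)))
      (All.tabulate λ x∈ → proj₂ (∈-filter⁻ late? {xs = allFin n}
        (proj₁ (∈-cartesianProduct⁻ (filter late? (allFin n)) (allFin (suc k)) x∈))))

-- Placing one more vertex in the order

module OrderNext (c : PairColouring n (suc k)) (c-sym : Symmetric c) (poly : Polychromatic c)
                 (s : ℕ) (s<n : s < n) (ord : OrderedUpTo s c) where

  open MonochromaticDegree c s

  next : Fin n
  next = fromℕ< s<n

  s≤next : s ≤ toℕ next
  s≤next = ≤-reflexive (sym (toℕ-fromℕ< s<n))

  module Recolour (v : Fin n) (a : Fin (suc k)) (s≤v : s ≤ toℕ v)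
                  (degree-max : ∀ y b → s ≤ toℕ y → degree y b ≤ degree v a) where

    Touched : Fin n → Fin n → Set
    Touched i j = (i ≡ v × s ≤ toℕ j) ⊎ (j ≡ v × s ≤ toℕ i)

    touched? : ∀ i j → Dec (Touched i j)
    touched? i j = ((i ≟ v) ×-dec (s ≤? toℕ j)) ⊎-dec ((j ≟ v) ×-dec (s ≤? toℕ i))

    touched-sym : ∀ {i j} → Touched i j → Touched j i
    touched-sym (inj₁ t) = inj₂ t
    touched-sym (inj₂ t) = inj₁ t

    recoloured : PairColouring n (suc k)
    recoloured i j = if does (touched? i j) then a else c i j

    recoloured-touched : ∀ {i j} → Touched i j → recoloured i j ≡ a
    recoloured-touched {i} {j} t = cong (if_then a else c i j) (dec-true (touched? i j) t)

    recoloured-untouched : ∀ {i j} → ¬ Touched i j → recoloured i j ≡ c i j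
    recoloured-untouched {i} {j} ¬t = cong (if_then a else c i j) (dec-false (touched? i j) ¬t)

    recoloured-sym : Symmetric recoloured
    recoloured-sym i j with touched? i j
    ... | yes t = trans (recoloured-touched t) (sym (recoloured-touched (touched-sym t)))
    ... | no ¬t = trans (recoloured-untouched ¬t) (trans (c-sym i j) (sym (recoloured-untouched (¬t ∘ touched-sym))))

    -- If vy is the only b-coloured edge of a perfect matching, twisting it along an a-coloured
    -- edge vu yields a matching whose b-coloured edge can only be the one from y to the mate of u.
    -- So y has more b-coloured edges (vy included) than v has a-coloured ones.
    module Exchange (σ : Matching n) {b : Fin (suc k)} (a≢b : a ≢ b)
                    (s≤y : s ≤ toℕ (mate σ v)) (cvy : c v (mate σ v) ≡ b)
                    (unique : ∀ w → c w (mate σ w) ≡ b → w ≡ v ⊎ w ≡ mate σ v) where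

      y : Fin n
      y = mate σ v

      σy≡v : mate σ y ≡ v
      σy≡v = involutive σ v

      module _ (u : Fin n) (s≤u : s ≤ toℕ u) (u≢v : u ≢ v) (cvu : c v u ≡ a) where

        u≢y : u ≢ y
        u≢y u≡y = a≢b (trans (sym cvu) (trans (cong (c v) u≡y) cvy))

        σu≢y : mate σ u ≢ y
        σu≢y σu≡y = u≢v (mate-injective σ σu≡y)

        twist-colour : Twist σ y u → c y (mate σ u) ≡ b
        twist-colour T with poly (twisted T) b
        ... | w , cw with w ≟ y
        ... | yes refl = trans (cong (c y) (sym (twist-y T))) cw
        ... | no w≢y with w ≟ u
        -- At `u`, and likewise at `mate σ y`, the twisted matching has the edge `uv`, whose colour
        -- is `a`.
        ... | yes refl = contradiction
                (trans (sym cvu) (trans (c-sym v u) (trans (cong (c u) (sym (trans (twist-u T) σy≡v))) cw))) a≢b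
        ... | no w≢u with w ≟ mate σ y
        ... | yes refl = contradiction
                (trans (sym cvu) (trans (sym (cong₂ c σy≡v (twist-σy T))) cw)) a≢b
        ... | no w≢σy with w ≟ mate σ u
        ... | yes refl = trans (c-sym y _) (trans (cong (c (mate σ u)) (sym (twist-σu T))) cw)
        -- Away from the four exchanged vertices the edge belongs to `σ`, whose only `b`-coloured
        -- edge is `vy`.
        ... | no w≢σu with unique w (trans (cong (c w) (sym (twist-off T w w≢y w≢u w≢σy w≢σu))) cw)
        ... | inj₁ w≡v = contradiction (trans w≡v (sym σy≡v)) w≢σy
        ... | inj₂ w≡y = contradiction w≡y w≢y

        colour-y-σu : c y (mate σ u) ≡ b
        colour-y-σu = twist-colour (twist σ y u (u≢y ∘ sym) σu≢y)

        -- If `mate σ u` were already ordered, its edges to `u` and to `y` would have the same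
        -- colour `b`, and `σ` would have a second `b`-coloured edge.
        s≤σu : s ≤ toℕ (mate σ u)
        s≤σu with s ≤? toℕ (mate σ u)
        ... | yes s≤σu = s≤σu
        ... | no s≰σu with unique (mate σ u)
                (trans (cong (c (mate σ u)) (involutive σ u))
                (trans (ord (mate σ u) u y σu<s (<-≤-trans σu<s s≤u) (<-≤-trans σu<s s≤y))
                (trans (c-sym (mate σ u) y) colour-y-σu)))
                where
                σu<s : toℕ (mate σ u) < s
                σu<s = ≰⇒> s≰σu
        ... | inj₁ σu≡v = contradiction (subst (λ z → s ≤ toℕ z) (sym σu≡v) s≤v) s≰σu
        ... | inj₂ σu≡y = contradiction σu≡y σu≢y

      -- The map `mate σ` sends the `a`-neighbours of `v` injectively to `b`-neighbours of `y`. The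
      -- vertex `y` is not an `a`-neighbour of `v`, yet its mate `v` is a `b`-neighbour of `y`; this
      -- makes the inequality strict.
      degree-increases : degree v a < degree y b
      degree-increases = subst (degree v a <_) (count-mate σ (neighbour? y b))
        (count-strict (neighbour? v a) (neighbour? y b ∘ mate σ)
          (λ { u (s≤u , u≢v , cvu) → s≤σu u s≤u u≢v cvu , σu≢y u s≤u u≢v cvu , colour-y-σu u s≤u u≢v cvu })
          y
          (λ { (_ , _ , cvy≡a) → a≢b (trans (sym cvy≡a) cvy) })
          (subst (Neighbour y b) (sym σy≡v) (s≤v , mate≢ σ v ∘ sym , trans (c-sym y v) cvy)))

    -- If `b` is lost on `σ`, every `b`-coloured edge of `σ` was recoloured and so contains `v`:
    -- there is just the edge from `v` to its mate. It now has colour `a`, so `a ≢ b`, and the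
    -- exchange contradicts the choice of `v` and `a`.
    recoloured-polychromatic : Polychromatic recoloured
    recoloured-polychromatic σ b with any? (λ w → recoloured w (mate σ w) ≟ b)
    ... | yes found = found
    ... | no missing = contradiction degree-increases (≤⇒≯ (degree-max (mate σ v) b (proj₁ hit)))
      where
      touched : ∀ w → c w (mate σ w) ≡ b → Touched w (mate σ w)
      touched w cw with touched? w (mate σ w)
      ... | yes t = t
      ... | no ¬t = contradiction (w , trans (recoloured-untouched ¬t) cw) missing

      locate : ∀ {w} → Touched w (mate σ w) → w ≡ v ⊎ w ≡ mate σ v
      locate (inj₁ (w≡v , _))  = inj₁ w≡v
      locate (inj₂ (σw≡v , _)) = inj₂ (trans (sym (involutive σ _)) (cong (mate σ) σw≡v))

      hit : s ≤ toℕ (mate σ v) × c v (mate σ v) ≡ b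
      hit with poly σ b
      ... | w , cw with touched w cw
      ... | inj₁ (refl , s≤σw) = s≤σw , cw
      ... | inj₂ (σw≡v , s≤w)  =
        subst (λ z → s ≤ toℕ z) w≡σv s≤w ,
        trans (cong₂ c (sym σw≡v) (sym w≡σv)) (trans (c-sym _ w) cw)
        where
        w≡σv : w ≡ mate σ v
        w≡σv = trans (sym (involutive σ w)) (cong (mate σ) σw≡v)

      open Exchange σ
        (λ a≡b → missing (v , trans (recoloured-touched (inj₁ (refl , proj₁ hit))) a≡b))
        (proj₁ hit) (proj₂ hit) (λ w → locate ∘ touched w)

    π : Permutation′ n
    π = transpose next v

    ordered : PairColouring n (suc k)
    ordered i j = recoloured (π ⟨$⟩ʳ i) (π ⟨$⟩ʳ j)

    ordered-polychromatic : Polychromatic ordered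
    ordered-polychromatic = relabel-polychromatic π {recoloured} recoloured-polychromatic

    ordered-sym : Symmetric ordered
    ordered-sym i j = recoloured-sym (π ⟨$⟩ʳ i) (π ⟨$⟩ʳ j)

    π-fixes : ∀ {i} → toℕ i < s → π ⟨$⟩ʳ i ≡ i
    π-fixes i<s = transpose-fixes next v
      (λ { refl → <⇒≱ i<s s≤next }) (λ { refl → <⇒≱ i<s s≤v })

    π-late : ∀ {i} → s ≤ toℕ i → s ≤ toℕ (π ⟨$⟩ʳ i)
    π-late {i} s≤i with i ≟ next
    ... | yes refl = s≤v
    ... | no i≢next with i ≟ v
    ... | yes _ = s≤next
    ... | no  _ = s≤i

    π-preserves-< : ∀ (i j : Fin n) → toℕ i < s → i Fin.< j → i Fin.< π ⟨$⟩ʳ j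
    π-preserves-< i j i<s i<j with toℕ j <? s
    ... | yes j<s = subst (i Fin.<_) (sym (π-fixes j<s)) i<j
    ... | no  j≮s = <-≤-trans i<s (π-late (≮⇒≥ j≮s))

    -- Edges at vertices below `s` keep their colours, and `π` moves only positions from `s` on.
    -- Position `s` is now held by `v`, whose edges to unordered vertices all have colour `a`.
    ordered-ordered : OrderedUpTo (suc s) ordered
    ordered-ordered i j j′ i<1+s i<j i<j′ with toℕ i <? s
    ... | yes i<s = trans (early i<j) (trans
            (ord i (π ⟨$⟩ʳ j) (π ⟨$⟩ʳ j′) i<s (π-preserves-< i j i<s i<j) (π-preserves-< i j′ i<s i<j′))
            (sym (early i<j′)))
      where
      untouched : ∀ {j} → ¬ Touched i j
      untouched (inj₁ (refl , _))  = <⇒≱ i<s s≤v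
      untouched (inj₂ (_ , s≤i))   = <⇒≱ i<s s≤i
      early : ∀ {j} → i Fin.< j → ordered i j ≡ c i (π ⟨$⟩ʳ j)
      early {j} i<j = trans (cong (λ z → recoloured z (π ⟨$⟩ʳ j)) (π-fixes i<s))
                            (recoloured-untouched {i} {π ⟨$⟩ʳ j} untouched)
    ... | no i≮s = trans (late i<j) (sym (late i<j′))
      where
      i≡next : i ≡ next
      i≡next = toℕ-injective (trans (≤-antisym (≤-pred i<1+s) (≮⇒≥ i≮s)) (sym (toℕ-fromℕ< s<n)))
      late : ∀ {j} → i Fin.< j → ordered i j ≡ a
      late {j} i<j = recoloured-touched {π ⟨$⟩ʳ i} {π ⟨$⟩ʳ j} (inj₁
        (trans (cong (π ⟨$⟩ʳ_) i≡next) (transposeˡ next v) , π-late (≤-trans (≮⇒≥ i≮s) (<⇒≤ i<j))))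

exists-ordered : (c : PairColouring n (suc k)) → Symmetric c → Polychromatic c → ∀ s → s ≤ n →
                 ∃ λ (c′ : PairColouring n (suc k)) → Symmetric c′ × Polychromatic c′ × OrderedUpTo s c′
exists-ordered c c-sym poly zero    _   = c , c-sym , poly , λ _ _ _ ()
exists-ordered c c-sym poly (suc s) s<n with exists-ordered c c-sym poly s (<⇒≤ s<n)
... | c′ , c′-sym , poly′ , ord with MonochromaticDegree.exists-max c′ s s<n
... | v , a , s≤v , degree-max = ordered , ordered-sym , ordered-polychromatic , ordered-ordered
  where open OrderNext.Recolour c′ c′-sym poly′ s s<n ord v a s≤v degree-max

-- Vertex colours, majorities in prefixes, and matchings that avoid a colour

-- In the application `f i` is the common colour of the edges from `i` to later vertices.
module VertexColours (f : Fin n → Fin k) where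

  Inside Outside : ℕ → Fin k → Fin n → Set
  Inside  m t i = toℕ i < m × f i ≡ t
  Outside m t i = toℕ i < m × f i ≢ t

  inside? : ∀ m t → Decidable (Inside m t)
  inside? m t i = (toℕ i <? m) ×-dec (f i ≟ t)

  outside? : ∀ m t → Decidable (Outside m t)
  outside? m t i = (toℕ i <? m) ×-dec ¬? (f i ≟ t)

  Majority : ℕ → Fin k → Set
  Majority m t = count (outside? m t) < count (inside? m t)

  majority? : ∀ m t → Dec (Majority m t)
  majority? m t = count (outside? m t) <? count (inside? m t)

  module Position {m : ℕ} (m<n : m < n) where

    x : Fin n
    x = fromℕ< m<n

    toℕ-x : toℕ x ≡ m
    toℕ-x = toℕ-fromℕ< m<n

    last-or-before : ∀ {i} → toℕ i < suc m → toℕ i < m ⊎ i ≡ x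
    last-or-before i<1+m with m≤n⇒m<n∨m≡n (≤-pred i<1+m)
    ... | inj₁ i<m = inj₁ i<m
    ... | inj₂ i≡m = inj₂ (toℕ-injective (trans i≡m (sym toℕ-x)))

  -- When colour t is not in the majority in any prefix, the vertices coloured t can be matched
  -- one after the other to earlier vertices not coloured t.
  module Avoid (t : Fin k) (minority : ∀ m → m ≤ n → ¬ Majority m t) (base : Matching n) where

    AvoidsUpTo : ℕ → Matching n → Set
    AvoidsUpTo m σ = ∀ i → toℕ i < m → f i ≡ t → toℕ (mate σ i) < toℕ i

    module Extend {m} (m<n : m < n) (σ : Matching n) (avoids : AvoidsUpTo m σ) where
      open Position m<n

      already : (f x ≡ t → toℕ (mate σ x) < toℕ x) → AvoidsUpTo (suc m) σ
      already ok i i<1+m fi≡t with last-or-before i<1+m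
      ... | inj₁ i<m  = avoids i i<m fi≡t
      ... | inj₂ refl = ok fi≡t

      free? : Decidable (λ u → Outside m t u × ¬ Inside m t (mate σ u))
      free? u = outside? m t u ×-dec ¬? (inside? m t (mate σ u))

      -- Otherwise `mate σ` would inject the vertices before `x` not coloured `t` into those
      -- coloured `t`; with `x` added, `t` would have a strict majority.
      free : f x ≡ t → ∃ λ u → Outside m t u × ¬ Inside m t (mate σ u)
      free fx≡t with any? free?
      ... | yes found = found
      ... | no  none  = contradiction majority (minority (suc m) m<n)
        where
        mated : ∀ u → Outside m t u → Inside m t (mate σ u)
        mated u out with inside? m t (mate σ u)
        ... | yes ins = ins
        ... | no ¬ins = contradiction (u , out , ¬ins) none
        open ≤-Reasoning
        majority : Majority (suc m) t
        majority = begin-strict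
          count (outside? (suc m) t)
            ≤⟨ count-mono (outside? (suc m) t) (outside? m t) before ⟩
          count (outside? m t)
            ≤⟨ count-mono (outside? m t) (inside? m t ∘ mate σ) mated ⟩
          count (inside? m t ∘ mate σ)
            ≡⟨ count-mate σ (inside? m t) ⟩
          count (inside? m t)
            <⟨ count-strict (inside? m t) (inside? (suc m) t)
                 (λ { i (i<m , fi≡t) → m<n⇒m<1+n i<m , fi≡t }) x
                 (λ { (x<m , _) → <-irrefl toℕ-x x<m })
                 (s≤s (≤-reflexive toℕ-x) , fx≡t) ⟩
          count (inside? (suc m) t) ∎
          where
          before : ∀ i → Outside (suc m) t i → Outside m t i
          before i (i<1+m , fi≢t) with last-or-before i<1+m
          ... | inj₁ i<m  = i<m , fi≢t
          ... | inj₂ refl = contradiction fx≡t fi≢t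

      module Rematch (fx≡t : f x ≡ t) (x<σx : toℕ x < toℕ (mate σ x)) where

        u : Fin n
        u = proj₁ (free fx≡t)

        u<m : toℕ u < m
        u<m = proj₁ (proj₁ (proj₂ (free fx≡t)))

        fu≢t : f u ≢ t
        fu≢t = proj₂ (proj₁ (proj₂ (free fx≡t)))

        m<σx : m < toℕ (mate σ x)
        m<σx = subst (_< toℕ (mate σ x)) toℕ-x x<σx

        T : Twist σ (mate σ x) u
        T = twist σ (mate σ x) u
          (λ σx≡u → <-asym u<m (subst (λ z → m < toℕ z) σx≡u m<σx))
          (λ σu≡σx → fu≢t (trans (cong f (mate-injective σ σu≡σx)) fx≡t))

        mate-x : mate (twisted T) x ≡ u
        mate-x = trans (cong (mate (twisted T)) (sym (involutive σ x))) (twist-σy T)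

        -- The vertex `x` is rematched to the earlier vertex `u`. The other vertices whose mates
        -- change are `mate σ x`, which comes after `x`, `u`, which is not coloured `t`, and the old
        -- mate of `u`, which by the choice of `u` is no earlier vertex coloured `t`.
        twisted-avoids : AvoidsUpTo (suc m) (twisted T)
        twisted-avoids i i<1+m fi≡t with last-or-before i<1+m
        ... | inj₂ refl = subst₂ _<_ (cong toℕ (sym mate-x)) (sym toℕ-x) u<m
        ... | inj₁ i<m  = subst (λ z → toℕ z < toℕ i) (sym unchanged) (avoids i i<m fi≡t)
          where
          unchanged : mate (twisted T) i ≡ mate σ i
          unchanged = twist-off T i
            (λ { refl → <-asym i<m m<σx })
            (λ { refl → fu≢t fi≡t })
            (λ i≡σσx → <-irrefl (trans (cong toℕ (trans i≡σσx (involutive σ x))) toℕ-x) i<m)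
            (λ { refl → proj₂ (proj₂ (free fx≡t)) (i<m , fi≡t) })

      extended : ∃ (AvoidsUpTo (suc m))
      extended with f x ≟ t
      ... | no fx≢t = σ , already λ fx≡t → contradiction fx≡t fx≢t
      ... | yes fx≡t with ℕ-<-cmp (toℕ (mate σ x)) (toℕ x)
      ... | tri< σx<x _ _ = σ , already λ _ → σx<x
      ... | tri≈ _ eq _   = contradiction (toℕ-injective eq) (mate≢ σ x)
      ... | tri> _ _ x<σx = twisted T , twisted-avoids
        where open Rematch fx≡t x<σx

    avoiding : ∀ m → m ≤ n → ∃ (AvoidsUpTo m)
    avoiding zero    _   = base , λ _ ()
    avoiding (suc m) m<n with avoiding m (<⇒≤ m<n)
    ... | σ , avoids = Extend.extended m<n σ avoids

  -- Doubling along the colours that reach a majority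

  open import Data.List.Membership.DecPropositional (_≟_ {k}) using (_∈?_)

  ListedWithin : ℕ → List (Fin k) → Fin n → Set
  ListedWithin m L i = toℕ i < m × f i ∈ L

  listed? : ∀ m L → Decidable (ListedWithin m L)
  listed? m L i = (toℕ i <? m) ×-dec (f i ∈? L)

  -- A colour that reaches the majority for the first time outnumbers all the colours that
  -- reached it before taken together, so the number of vertices of these colours doubles.
  majority-colours : ∀ m → m ≤ n → ∃ λ L →
    (∀ t m′ → m′ ≤ m → Majority m′ t → t ∈ L) × 2 ^ length L ≤ suc (count (listed? m L))
  majority-colours zero _ = [] , none , s≤s z≤n
    where
    none : ∀ t m′ → m′ ≤ 0 → Majority m′ t → t ∈ []
    none t .0 z≤n maj = contradiction maj
      (≤⇒≯ (count-mono (inside? 0 t) (outside? 0 t) λ { _ (() , _) }))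
  majority-colours (suc m) m<n with majority-colours m (<⇒≤ m<n)
  ... | L , complete , large = result
    where
    open Position m<n
    open ≤-Reasoning

    -- Lengthening the prefix by `x` adds no vertex of a colour other than `f x`, so only `f x` can
    -- gain a majority here.
    persists : ∀ {t} → t ≢ f x → Majority (suc m) t → Majority m t
    persists {t} t≢fx maj = begin-strict
      count (outside? m t)
        ≤⟨ count-mono (outside? m t) (outside? (suc m) t) (λ { i (i<m , fi≢t) → m<n⇒m<1+n i<m , fi≢t }) ⟩
      count (outside? (suc m) t)
        <⟨ maj ⟩
      count (inside? (suc m) t)
        ≤⟨ count-mono (inside? (suc m) t) (inside? m t) before ⟩
      count (inside? m t) ∎
      where
      before : ∀ i → Inside (suc m) t i → Inside m t i
      before i (i<1+m , fi≡t) with last-or-before i<1+m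
      ... | inj₁ i<m  = i<m , fi≡t
      ... | inj₂ refl = contradiction (sym fi≡t) t≢fx

    extend : ∀ {L′} → (∀ {t} → t ∈ L → t ∈ L′) → (Majority (suc m) (f x) → f x ∈ L′) →
             ∀ t m′ → m′ ≤ suc m → Majority m′ t → t ∈ L′
    extend L⊆L′ new t m′ m′≤1+m maj with m≤n⇒m<n∨m≡n m′≤1+m
    ... | inj₁ m′<1+m = L⊆L′ (complete t m′ (≤-pred m′<1+m) maj)
    ... | inj₂ refl with t ≟ f x
    ... | yes refl = new maj
    ... | no t≢fx  = L⊆L′ (complete t m ≤-refl (persists t≢fx maj))

    grows : count (listed? m L) ≤ count (listed? (suc m) L)
    grows = count-mono (listed? m L) (listed? (suc m) L) λ { i (i<m , fi∈L) → m<n⇒m<1+n i<m , fi∈L }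

    result : ∃ λ L′ → (∀ t m′ → m′ ≤ suc m → Majority m′ t → t ∈ L′) ×
                      2 ^ length L′ ≤ suc (count (listed? (suc m) L′))
    result with f x ∈? L
    ... | yes fx∈L = L , extend (λ t∈L → t∈L) (λ _ → fx∈L) , ≤-trans large (s≤s grows)
    ... | no fx∉L with majority? (suc m) (f x)
    ... | no ¬maj = L , extend (λ t∈L → t∈L) (λ maj → contradiction maj ¬maj) , ≤-trans large (s≤s grows)
    ... | yes maj = f x ∷ L , extend there (λ _ → here refl) , (begin
      2 * 2 ^ length L
        ≤⟨ *-monoʳ-≤ 2 (≤-trans large (s≤s grows)) ⟩
      2 * suc W
        ≡⟨ cong (suc W +_) (+-identityʳ (suc W)) ⟩
      suc W + suc W
        -- The `W` listed vertices all have colours other than `f x`, so the strict majority gives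
        -- at least `suc W` vertices coloured `f x`.
        ≤⟨ s≤s (+-monoʳ-≤ W (≤-<-trans W≤outside maj)) ⟩
      suc (W + count (inside? (suc m) (f x)))
        ≤⟨ s≤s (count-⊎ (listed? (suc m) L) (inside? (suc m) (f x)) (listed? (suc m) (f x ∷ L))
             (λ { i (_ , fi∈L) (_ , fi≡fx) → fx∉L (subst (_∈ L) fi≡fx fi∈L) })
             (λ { i (i<m , fi∈L) → i<m , there fi∈L })
             (λ { i (i<m , fi≡fx) → i<m , here fi≡fx })) ⟩
      suc (count (listed? (suc m) (f x ∷ L))) ∎)
      where
      W : ℕ
      W = count (listed? (suc m) L)
      W≤outside : W ≤ count (outside? (suc m) (f x))
      W≤outside = count-mono (listed? (suc m) L) (outside? (suc m) (f x))
        λ { i (i<m , fi∈L) → i<m , λ fi≡fx → fx∉L (subst (_∈ L) fi≡fx fi∈L) }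

-- The bound for polychromatic pair colourings

∈-complete⇒≤length : (L : List (Fin k)) → (∀ t → t ∈ L) → k ≤ length L
∈-complete⇒≤length L all∈ =
  injective⇒≤ λ {s} {t} → index-injective (setoid _) (all∈ s) (all∈ t)

-- An edge takes the colour of its smaller end. For a colour `t` with no majority in any prefix
-- there is a matching in which each vertex coloured `t` is the larger end of its edge, so `t` is
-- missed. Hence the list `L` contains all `k` colours.
ordered-bound : (c : PairColouring n k) → Symmetric c → Polychromatic c → Matching n →
                (f : Fin n → Fin k) → (∀ i j → i Fin.< j → c i j ≡ f i) → 2 ^ k ≤ suc n
ordered-bound {n} {k} c c-sym poly base f c≡f with VertexColours.majority-colours f n ≤-refl
... | L , complete , large = begin
  2 ^ k                   ≤⟨ ^-monoʳ-≤ 2 (∈-complete⇒≤length L all∈L) ⟩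
  2 ^ length L            ≤⟨ large ⟩
  suc (count (listed? n L)) ≤⟨ s≤s (count≤n (listed? n L)) ⟩
  suc n                   ∎
  where
  open VertexColours f
  open ≤-Reasoning
  all∈L : ∀ t → t ∈ L
  all∈L t with any? (λ (m : Fin (suc n)) → majority? (toℕ m) t)
  ... | yes (m , maj) = complete t (toℕ m) (toℕ≤pred[n] m) maj
  ... | no none with Avoid.avoiding t minority base n ≤-refl
    where
    minority : ∀ m → m ≤ n → ¬ Majority m t
    minority m m≤n maj = none (fromℕ< (s≤s m≤n) , subst (λ z → Majority z t) (sym (toℕ-fromℕ< (s≤s m≤n))) maj)
  ... | σ , avoids with poly σ t
  ... | w , cw with <-cmp w (mate σ w)
  ... | tri< w<σw _ _ = contradiction (avoids w (toℕ<n w) (trans (sym (c≡f _ _ w<σw)) cw)) (<-asym w<σw)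
  ... | tri≈ _ w≡σw _ = contradiction (sym w≡σw) (mate≢ σ w)
  ... | tri> _ _ σw<w = contradiction
          (avoids (mate σ w) (toℕ<n _) (trans (sym (c≡f _ _ σw<w)) (trans (c-sym _ w) cw)))
          (<-asym (subst (λ z → mate σ w Fin.< z) (sym (involutive σ w)) σw<w))

polychromatic-bound : (c : PairColouring n (suc k)) → Symmetric c → Polychromatic c → Matching n →
                      2 ^ suc k ≤ suc n
polychromatic-bound {zero}  c c-sym poly base = contradiction (proj₁ (poly base zero)) λ ()
polychromatic-bound {suc n} {k} c c-sym poly base =
  conclude (exists-ordered c c-sym poly (suc n) ≤-refl)
  where
  conclude : (∃ λ (c′ : PairColouring (suc n) (suc k)) →
                Symmetric c′ × Polychromatic c′ × OrderedUpTo (suc n) c′) → 2 ^ suc k ≤ 2 + n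
  conclude (c′ , c′-sym , poly′ , ord) =
    -- The colour of a vertex is read off its edge to the last vertex; the last vertex itself gets
    -- the diagonal value.
    ordered-bound c′ c′-sym poly′ base (λ i → c′ i (fromℕ n)) λ i j i<j →
      ord i j (fromℕ n) (toℕ<n i) i<j
          (<-≤-trans i<j (≤-trans (toℕ≤pred[n] j) (≤-reflexive (sym (toℕ-fromℕ n)))))

-- From edge sets and edge colourings to involutions and pair colourings

edge-≡ : {i j : Fin n} {p q : i Fin.< j} → _≡_ {A = Edge n} ((i , j) , p) ((i , j) , q)
edge-≡ {i = i} {j} {p} {q} = cong ((i , j) ,_) (<-irrelevant p q)

edgeSet : Matching n → EdgeSet n
edgeSet σ ((i , j) , _) = does (mate σ i ≟ j)

module _ (σ : Matching n) where

  ∈edgeSet⇒mate : ∀ i j (i<j : i Fin.< j) → edgeSet σ ((i , j) , i<j) ≡ true → mate σ i ≡ j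
  ∈edgeSet⇒mate i j _ M≡true with mate σ i ≟ j
  ... | yes σi≡j = σi≡j

  edgeSet-perfect : IsPerfectMatching (edgeSet σ)
  edgeSet-perfect v with <-cmp v (mate σ v)
  ... | tri< v<σv _ _ = ((v , mate σ v) , v<σv) , dec-true (mate σ v ≟ mate σ v) refl , inj₁ refl , unique
    where
    unique : ∀ e → edgeSet σ e ≡ true → Incident v e → e ≡ ((v , mate σ v) , v<σv)
    unique ((i , j) , i<j) M v∈e with ∈edgeSet⇒mate i j i<j M | v∈e
    ... | refl | inj₁ refl = edge-≡
    ... | refl | inj₂ refl = contradiction (subst (mate σ i Fin.<_) (involutive σ i) v<σv) (<-asym i<j)
  ... | tri≈ _ v≡σv _ = contradiction (sym v≡σv) (mate≢ σ v)
  ... | tri> _ _ σv<v = ((mate σ v , v) , σv<v) , dec-true (mate σ (mate σ v) ≟ v) (involutive σ v) , inj₂ refl , unique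
    where
    unique : ∀ e → edgeSet σ e ≡ true → Incident v e → e ≡ ((mate σ v , v) , σv<v)
    unique ((i , j) , i<j) M v∈e with ∈edgeSet⇒mate i j i<j M | v∈e
    ... | refl | inj₁ refl = contradiction i<j (<-asym σv<v)
    ... | refl | inj₂ refl = lemma (involutive σ i) i<j σv<v
      where
      lemma : ∀ {i i′ j : Fin n} → i′ ≡ i → (p : i Fin.< j) (q : i′ Fin.< j) →
              _≡_ {A = Edge n} ((i , j) , p) ((i′ , j) , q)
      lemma refl p q = edge-≡

module FromColouring (colour : Edge n → Fin (suc k)) where

  pairColour : PairColouring n (suc k)
  pairColour i j with <-cmp i j
  ... | tri< i<j _ _ = colour ((i , j) , i<j)
  -- Default value on the diagonal, which is not an edge.
  ... | tri≈ _ _ _   = zero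
  ... | tri> _ _ j<i = colour ((j , i) , j<i)

  pairColour-< : ∀ {i j} (i<j : i Fin.< j) → pairColour i j ≡ colour ((i , j) , i<j)
  pairColour-< {i} {j} i<j with <-cmp i j
  ... | tri< _ _ _   = cong colour edge-≡
  ... | tri≈ i≮j _ _ = contradiction i<j i≮j
  ... | tri> i≮j _ _ = contradiction i<j i≮j

  pairColour-> : ∀ {i j} (i<j : i Fin.< j) → pairColour j i ≡ colour ((i , j) , i<j)
  pairColour-> {i} {j} i<j with <-cmp j i
  ... | tri< _ _ i≮j = contradiction i<j i≮j
  ... | tri≈ _ _ i≮j = contradiction i<j i≮j
  ... | tri> _ _ _   = cong colour edge-≡

  pairColour-sym : Symmetric pairColour
  pairColour-sym i j with <-cmp i j
  ... | tri< i<j _ _  = sym (pairColour-> i<j)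
  ... | tri> _ _ j<i  = sym (pairColour-< j<i)
  ... | tri≈ _ refl _ with <-cmp i i
  ... | tri< i<i _ _  = contradiction i<i (<-irrefl refl)
  ... | tri≈ _ _ _    = refl
  ... | tri> _ _ i<i  = contradiction i<i (<-irrefl refl)

-- Equality in `2 ^ suc k ≤ suc n` would make both `n` and `suc n` even.
2^k≤n : 2 ∣ n → (c : Coloring n (suc k)) → IsF1Polychromatic c → 2 ^ suc k ≤ n
2^k≤n {n} {k} 2∣n c poly = ≤-pred (≤∧≢⇒< bound λ eq →
  contradiction (∣1⇒≡1 (∣m+n∣m⇒∣n (subst (2 ∣_) (trans eq (+-comm 1 n)) (m∣m*n (2 ^ k))) 2∣n)) λ ())
  where
  open FromColouring (Coloring.colour c)
  bound : 2 ^ suc k ≤ suc n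
  bound = polychromatic-bound pairColour pairColour-sym poly′ (reversal 2∣n)
    where
    poly′ : Polychromatic pairColour
    poly′ σ a with poly (edgeSet σ) (edgeSet-perfect σ) a
    ... | ((i , j) , i<j) , M , refl with ∈edgeSet⇒mate σ i j i<j M
    ... | refl = i , pairColour-< i<j

upper-bound : 2 ∣ n → ∀ k → Σ (Coloring n k) IsF1Polychromatic → k ≤ ⌊log₂ n ⌋
upper-bound 2∣n zero    _          = z≤n
upper-bound 2∣n (suc k) (c , poly) =
  subst (_≤ _) (⌊log₂[2^n]⌋≡n (suc k)) (⌊log₂⌋-mono-≤ (2^k≤n 2∣n c poly))

-- The binary logarithm

-- The accessibility argument lets the induction follow the recursion of `⌊log2⌋`, which passes from
-- `2 + n` to `1 + ⌊ n /2⌋`.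
2^⌊log2⌋≤n : ∀ n (rec : Acc _<_ n) → 0 < n → 2 ^ ⌊log2⌋ n rec ≤ n
2^⌊log2⌋≤n (suc zero)    _        _ = ≤-refl
2^⌊log2⌋≤n (suc (suc n)) (acc rs) _ = begin
  2 * 2 ^ ⌊log2⌋ (suc h) _ ≤⟨ *-monoʳ-≤ 2 (2^⌊log2⌋≤n (suc h) _ (s≤s z≤n)) ⟩
  2 * suc h                ≡⟨ cong (suc h +_) (+-identityʳ (suc h)) ⟩
  suc h + suc h            ≡⟨ cong suc (+-suc h h) ⟩
  2 + (h + h)              ≤⟨ +-monoʳ-≤ 2 (+-monoʳ-≤ h (⌊n/2⌋≤⌈n/2⌉ n)) ⟩
  2 + (h + ⌈ n /2⌉)        ≡⟨ cong (2 +_) (⌊n/2⌋+⌈n/2⌉≡n n) ⟩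
  2 + n                    ∎
  where
  open ≤-Reasoning
  h : ℕ
  h = ⌊ n /2⌋

2^⌊log₂n⌋≤n : 0 < n → 2 ^ ⌊log₂ n ⌋ ≤ n
2^⌊log₂n⌋≤n = 2^⌊log2⌋≤n _ _

⌊log₂⌋-unique : ∀ a → 2 ^ a ≤ n → n < 2 ^ suc a → ⌊log₂ n ⌋ ≡ a
⌊log₂⌋-unique {n} a 2^a≤n n<2^1+a = ≤-antisym
  (≮⇒≥ λ a<log → <-irrefl refl (begin-strict
    n              <⟨ n<2^1+a ⟩
    2 ^ suc a      ≤⟨ ^-monoʳ-≤ 2 a<log ⟩
    2 ^ ⌊log₂ n ⌋  ≤⟨ 2^⌊log₂n⌋≤n (≤-trans (m^n>0 2 a) 2^a≤n) ⟩
    n              ∎))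
  (subst (_≤ ⌊log₂ n ⌋) (⌊log₂[2^n]⌋≡n a) (⌊log₂⌋-mono-≤ 2^a≤n))
  where open ≤-Reasoning

-- The logarithmic colouring

module LogColouring (k : ℕ) (2^1+k≤n : 2 ^ suc k ≤ n) where

  level : Fin n → ℕ
  level i = ⌊log₂ suc (toℕ i) ⌋

  colour : Edge n → Fin (suc k)
  colour ((i , _) , _) = fromℕ< (s≤s (m⊓n≤n (level i) k))

  colour-level : ∀ a i {j} (i<j : i Fin.< j) → level i ≡ toℕ a → colour ((i , j) , i<j) ≡ a
  colour-level a i _ eq = toℕ-injective (begin
    toℕ (fromℕ< (s≤s (m⊓n≤n (level i) k))) ≡⟨ toℕ-fromℕ< _ ⟩
    level i ⊓ k                            ≡⟨ cong (_⊓ k) eq ⟩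
    toℕ a ⊓ k                              ≡⟨ m≤n⇒m⊓n≡m (toℕ≤pred[n] a) ⟩
    toℕ a                                  ∎)
    where open ≡-Reasoning

  -- Vertices p, …, 2p, where p + 1 = 2 ^ a, form level a. There is one more of them than there
  -- are earlier vertices, so some edge of M at this level has its smaller end in the level.
  module ColourClass (M : EdgeSet n) (perfect : IsPerfectMatching M) (a : Fin (suc k)) where

    p : ℕ
    p = pred (2 ^ toℕ a)

    1+p≡2^a : suc p ≡ 2 ^ toℕ a
    1+p≡2^a = suc-pred (2 ^ toℕ a) {{m^n≢0 2 (toℕ a)}}

    2+2p≡2^1+a : suc p + suc p ≡ 2 ^ suc (toℕ a)
    2+2p≡2^1+a = trans (cong (suc p +_) (sym (+-identityʳ (suc p)))) (cong (2 *_) 1+p≡2^a)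

    vertex< : (r : Fin (suc p)) → p + toℕ r < n
    vertex< r = begin-strict
      p + toℕ r       <⟨ +-mono-≤-< (n≤1+n p) (toℕ<n r) ⟩
      suc p + suc p   ≡⟨ 2+2p≡2^1+a ⟩
      2 ^ suc (toℕ a) ≤⟨ ^-monoʳ-≤ 2 (toℕ<n a) ⟩
      2 ^ suc k       ≤⟨ 2^1+k≤n ⟩
      n               ∎
      where open ≤-Reasoning

    vertex : Fin (suc p) → Fin n
    vertex r = fromℕ< (vertex< r)

    toℕ-vertex : ∀ r → toℕ (vertex r) ≡ p + toℕ r
    toℕ-vertex r = toℕ-fromℕ< (vertex< r)

    vertex-injective : ∀ {r s} → vertex r ≡ vertex s → r ≡ s
    vertex-injective {r} {s} eq = toℕ-injective (+-cancelˡ-≡ p _ _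
      (trans (sym (toℕ-vertex r)) (trans (cong toℕ eq) (toℕ-vertex s))))

    edge : Fin n → Edge n
    edge v = proj₁ (perfect v)

    edge∈M : ∀ v → M (edge v) ≡ true
    edge∈M v = proj₁ (proj₂ (perfect v))

    lower upper : Fin n → Fin n
    lower v = proj₁ (proj₁ (edge v))
    upper v = proj₂ (proj₁ (edge v))

    lower<upper : ∀ v → lower v Fin.< upper v
    lower<upper v = proj₂ (edge v)

    end : ∀ v → v ≡ lower v ⊎ v ≡ upper v
    end v = proj₁ (proj₂ (proj₂ (perfect v)))

    lower≤ : ∀ v → toℕ (lower v) ≤ toℕ v
    lower≤ v with end v
    ... | inj₁ eq = ≤-reflexive (cong toℕ (sym eq))
    ... | inj₂ eq = ≤-trans (<⇒≤ (lower<upper v)) (≤-reflexive (cong toℕ (sym eq)))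

    same-lower : ∀ v w → lower v ≡ lower w → edge v ≡ edge w
    same-lower v w eq = trans (unique (edge v) (edge∈M v) (inj₁ refl))
                              (sym (unique (edge w) (edge∈M w) (inj₁ eq)))
      where
      unique : ∀ e → M e ≡ true → Incident (lower v) e → e ≡ edge (lower v)
      unique = proj₂ (proj₂ (proj₂ (perfect (lower v))))

    -- The smaller end lies between `p` and `vertex r`, which is at most `2p`, and so within level
    -- `a`.
    coloured : ∀ r → p ≤ toℕ (lower (vertex r)) → colour (edge (vertex r)) ≡ a
    coloured r p≤ = colour-level a _ (lower<upper (vertex r)) (⌊log₂⌋-unique (toℕ a)
      (≤-trans (≤-reflexive (sym 1+p≡2^a)) (s≤s p≤))
      (begin-strict
        suc (toℕ (lower (vertex r))) ≤⟨ s≤s (lower≤ (vertex r)) ⟩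
        suc (toℕ (vertex r))         ≡⟨ cong suc (toℕ-vertex r) ⟩
        suc p + toℕ r                <⟨ +-monoʳ-< (suc p) (toℕ<n r) ⟩
        suc p + suc p                ≡⟨ 2+2p≡2^1+a ⟩
        2 ^ suc (toℕ a)              ∎))
      where open ≤-Reasoning

    -- Pigeonhole: two of the `suc p` vertices would share one of the `p` earlier lower ends, hence
    -- the edge of `M` there; both would be its upper end.
    not-all-early : ¬ (∀ r → toℕ (lower (vertex r)) < p)
    not-all-early early = Fin.<⇒≢ r<s (vertex-injective (begin
      vertex r         ≡⟨ is-upper r ⟩
      upper (vertex r) ≡⟨ cong (proj₂ ∘ proj₁) (same-lower (vertex r) (vertex s) (toℕ-injective lowers)) ⟩
      upper (vertex s) ≡⟨ is-upper s ⟨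
      vertex s         ∎))
      where
      open ≡-Reasoning
      collision : ∃ λ r → ∃ λ s → r Fin.< s × fromℕ< (early r) ≡ fromℕ< (early s)
      collision = pigeonhole (n<1+n p) (λ r → fromℕ< (early r))
      r s : Fin (suc p)
      r = proj₁ collision
      s = proj₁ (proj₂ collision)
      r<s : r Fin.< s
      r<s = proj₁ (proj₂ (proj₂ collision))
      lowers : toℕ (lower (vertex r)) ≡ toℕ (lower (vertex s))
      lowers = begin
        toℕ (lower (vertex r))  ≡⟨ toℕ-fromℕ< (early r) ⟨
        toℕ (fromℕ< (early r))  ≡⟨ cong toℕ (proj₂ (proj₂ (proj₂ collision))) ⟩
        toℕ (fromℕ< (early s))  ≡⟨ toℕ-fromℕ< (early s) ⟩
        toℕ (lower (vertex s))  ∎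
      is-upper : ∀ r → vertex r ≡ upper (vertex r)
      is-upper r with end (vertex r)
      ... | inj₂ eq = eq
      ... | inj₁ eq = contradiction (early r)
              (≤⇒≯ (subst (p ≤_) (trans (sym (toℕ-vertex r)) (cong toℕ eq)) (m≤m+n p (toℕ r))))

    contains-colour : ∃ λ e → (M e ≡ true) × (colour e ≡ a)
    contains-colour with any? (λ r → p ≤? toℕ (lower (vertex r)))
    ... | yes (r , p≤) = edge (vertex r) , edge∈M (vertex r) , coloured r p≤
    ... | no none      = contradiction (λ r → ≰⇒> λ p≤ → none (r , p≤)) not-all-early

lower-bound : 2 ∣ n → ∀ k → 2 ^ suc k ≤ n → Σ (Coloring n (suc k)) IsF1Polychromatic
lower-bound 2∣n k 2^1+k≤n =
  -- Each colour already occurs on the reversal matching, so it is used.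
  record { colour = colour ; allUsed = λ a →
    let e , _ , ce≡a = ColourClass.contains-colour (edgeSet (reversal 2∣n)) (edgeSet-perfect (reversal 2∣n)) a
    in e , ce≡a } ,
  ColourClass.contains-colour
  where open LogColouring k 2^1+k≤n

-- The polychromatic number

theorem1 : (n : ℕ) → 0 < n → 2 ∣ n → PolyF1Is n ⌊log₂ n ⌋
theorem1 n@(suc _) 0<n 2∣n = optimal ⌊log₂ n ⌋ (2^⌊log₂n⌋≤n 0<n) (⌊log₂⌋-mono-≤ (∣⇒≤ 2∣n)) , upper-bound 2∣n
  where
  -- The condition `1 ≤ k` is available because an even positive `n` is at least 2.
  optimal : ∀ k → 2 ^ k ≤ n → 1 ≤ k → Σ (Coloring n k) IsF1Polychromatic
  optimal (suc k) 2^1+k≤n _ = lower-bound 2∣n k 2^1+k≤n
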